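{- Let $n\ge m\ge 1$ and $r=n-m+1$. The total number of occurrences of the subword $1^m$ within all the members of $NC_n$, i.e. $\sum_{\pi\in NC_n}\mu_{1^m}(\pi)$, equals $\binom{2r}{r+1}$, and the total number of occurrences of the subword $1^m2$, i.e. $\sum_{\pi\in NC_n}\mu_{1^m2}(\pi)$, equals $\binom{2r-1}{r+1}$.
   Context: A set partition of $[n]=\{1,\dots,n\}$ with blocks $B_1,\dots,B_k$ ordered so that $\min B_1<\cdots<\min B_k$ is represented by its canonical sequential form $\pi=\pi_1\cdots\pi_n$, where $i\in B_{\pi_i}$ for each $i$. It is non-crossing if $\pi$ contains no (not necessarily consecutive) subsequence of the form $a\,b\,a\,b$ with $a<b$. $NC_n$ denotes the set of non-crossing partitions of $[n]$, identified with their canonical sequential forms. A subword pattern is a finite sequence $\tau=\tau_1\cdots\tau_k$ of positive integers whose set of distinct letters is $[\ell]$ for some $\ell$. An occurrence of $\tau$ in a sequence $\rho_1\cdots\rho_n$ is an index $i\in[n-k+1]$ such that the string of consecutive letters $\rho_i\cdots\rho_{i+k-1}$ is order-isomorphic to $\tau$ (same relative order, including equalities). $\mu_\tau(\pi)$ denotes the number of occurrences of $\tau$ in $\pi$. $1^m$ is the word of $m$ ones, and $1^m2$ is $m$ ones followed by a $2$. -}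

module Defs where

open import Data.Bool using (true)
open import Data.Fin as Fin using (Fin; toℕ; fromℕ<; cast)
open import Data.Fin.Properties as Finₚ using (all?; any?; toℕ-injective; injective⇒≤)
open import Data.Fin.Subset using (Subset; _∈_; Nonempty)
open import Data.Fin.Subset.Properties using (_∈?_; nonempty?; ⊆-antisym)
open import Data.List as List using (List; []; _∷_; _++_; length; take; drop; filter; map; upTo; replicate; sum; cartesianProductWith)
open import Data.List.Membership.Propositional using () renaming (_∈_ to _∈ₗ_)
open import Data.List.Membership.Propositional.Properties using (∈-cartesianProductWith⁺; ∈-filter⁺; ∈-filter⁻; ∈-map⁺; ∈-upTo⁺)
open import Data.List.Relation.Unary.All using ([])
open import Data.List.Relation.Unary.AllPairs using ([]; _∷_)
open import Data.List.Relation.Unary.Any using (here)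
open import Data.List.Relation.Unary.Unique.Propositional using (Unique)
import Data.List.Relation.Unary.Unique.Propositional.Properties as Uniqueₚ
open import Data.Nat using (ℕ; zero; suc; _≤_; _<_; _∸_; s≤s; _≟_; _<?_)
open import Data.Nat.Properties using (suc-injective; ≤-trans)
open import Data.Product using (∃; _×_; _,_; proj₁; proj₂)
open import Data.Vec as Vec using (Vec; []; _∷_; lookup; tabulate; toList)
open import Data.Vec.Properties using (lookup∘tabulate; tabulate∘lookup; tabulate-cong; []=⇒lookup; lookup⇒[]=; ∷-injective)
open import Function using (_∘_)
open import Function.Bundles using (_⇔_; mk⇔; Equivalence)
open import Relation.Binary.PropositionalEquality using (_≡_; refl; sym; trans; cong; subst)
open import Relation.Nullary using (¬_; Dec; yes; no; does)
open import Relation.Nullary.Decidable using (map′; ¬?; _×-dec_; _→-dec_; dec-true)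

-- Set partitions of [n]; the element i ∈ {1,…,n} is the (i-1)-st element of
-- Fin n, and the block B_a is blocks (a-1).

_IsMinOf_ : ∀ {n} → Fin n → Subset n → Set
i IsMinOf B = i ∈ B × (∀ j → j ∈ B → i Fin.≤ j)

MinIncreasing : ∀ {n k} → (Fin k → Subset n) → Set
MinIncreasing B = ∀ a b → a Fin.< b → ∀ i j → i IsMinOf B a → j IsMinOf B b → i Fin.< j

record SetPartition (n : ℕ) : Set where
  field
    size     : ℕ
    blocks   : Fin size → Subset n
    nonempty : ∀ a → Nonempty (blocks a)
    disjoint : ∀ a b i → i ∈ blocks a → i ∈ blocks b → a ≡ b
    covering : ∀ i → ∃ λ a → i ∈ blocks a
    ordered  : MinIncreasing blocks

  blockOf : Fin n → Fin size
  blockOf i = proj₁ (covering i)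

open SetPartition

-- Letters are the 1-based block numbers.
canonicalForm : ∀ {n} → SetPartition n → Vec ℕ n
canonicalForm P = tabulate λ i → suc (toℕ (blockOf P i))

IsCanonical : ∀ {n} → Vec ℕ n → Set
IsCanonical {n} π = ∃ λ (P : SetPartition n) → canonicalForm P ≡ π

Crossing : ∀ {n} → Vec ℕ n → Set
Crossing π = ∃ λ i → ∃ λ j → ∃ λ k → ∃ λ l →
  i Fin.< j × j Fin.< k × k Fin.< l ×
  lookup π i ≡ lookup π k × lookup π j ≡ lookup π l × lookup π i < lookup π j

NonCrossing : ∀ {n} → Vec ℕ n → Set
NonCrossing π = ¬ Crossing π

nonCrossing? : ∀ {n} (π : Vec ℕ n) → Dec (NonCrossing π)
nonCrossing? π = ¬? (any? λ i → any? λ j → any? λ k → any? λ l →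
  (i Finₚ.<? j) ×-dec (j Finₚ.<? k) ×-dec (k Finₚ.<? l) ×-dec
  (lookup π i ≟ lookup π k) ×-dec (lookup π j ≟ lookup π l) ×-dec (lookup π i <? lookup π j))

-- IsCanonical is decided by testing, for each k ≤ n, whether the sets
-- { i | π_i = a }, 1 ≤ a ≤ k, are the blocks of a partition with increasing minima.

fibre : ∀ {n} → Vec ℕ n → ∀ {k} → Fin k → Subset n
fibre π a = tabulate λ i → does (lookup π i ≟ suc (toℕ a))

∈-fibre⁺ : ∀ {n k} (π : Vec ℕ n) (a : Fin k) {i} → lookup π i ≡ suc (toℕ a) → i ∈ fibre π a
∈-fibre⁺ π a {i} eq = lookup⇒[]= i _ (trans (lookup∘tabulate _ i) (dec-true (_ ≟ _) eq))

∈-fibre⁻ : ∀ {n k} (π : Vec ℕ n) (a : Fin k) {i} → i ∈ fibre π a → lookup π i ≡ suc (toℕ a)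
∈-fibre⁻ π a {i} i∈ = go (lookup π i ≟ suc (toℕ a)) (trans (sym (lookup∘tabulate _ i)) ([]=⇒lookup i∈))
  where
  go : ∀ {A : Set} (d : Dec A) → does d ≡ true → A
  go (yes x) _ = x

FibresPartition : ∀ {n} → Vec ℕ n → ℕ → Set
FibresPartition {n} π k =
  (∀ i → ∃ λ (a : Fin k) → i ∈ fibre π a) ×
  (∀ (a : Fin k) → Nonempty (fibre π a)) ×
  MinIncreasing (fibre π {k})

fibresPartition? : ∀ {n} (π : Vec ℕ n) k → Dec (FibresPartition π k)
fibresPartition? π k =
  all? (λ i → any? λ a → i ∈? fibre π a) ×-dec
  all? (λ a → nonempty? (fibre π a)) ×-dec
  all? (λ a → all? λ b → (a Finₚ.<? b) →-dec all? λ i → all? λ j →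
    isMin? i (fibre π a) →-dec (isMin? j (fibre π b) →-dec (i Finₚ.<? j)))
  where
  isMin? : ∀ {n} (i : Fin n) B → Dec (i IsMinOf B)
  isMin? i B = (i ∈? B) ×-dec all? λ j → (j ∈? B) →-dec (i Finₚ.≤? j)

fibresPartition⇒canonical : ∀ {n} (π : Vec ℕ n) {k} → FibresPartition π k → IsCanonical π
fibresPartition⇒canonical π {k} (cov , ne , ord) = P ,
  trans (tabulate-cong λ i → sym (∈-fibre⁻ π _ (proj₂ (cov i)))) (tabulate∘lookup π)
  where
  P : SetPartition _
  P = record
    { size     = k
    ; blocks   = fibre π
    ; nonempty = ne
    ; disjoint = λ a b i i∈a i∈b → toℕ-injective (suc-injective
        (trans (sym (∈-fibre⁻ π a i∈a)) (∈-fibre⁻ π b i∈b)))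
    ; covering = cov
    ; ordered  = ord
    }

size≤n : ∀ {n} (P : SetPartition n) → size P ≤ n
size≤n P = injective⇒≤ {f = λ a → proj₁ (nonempty P a)} λ {a} {b} eq →
  disjoint P a b _ (proj₂ (nonempty P a)) (subst (_∈ blocks P b) (sym eq) (proj₂ (nonempty P b)))

lookup-canonicalForm : ∀ {n} (P : SetPartition n) a {i} → i ∈ blocks P a →
  lookup (canonicalForm P) i ≡ suc (toℕ a)
lookup-canonicalForm P a {i} i∈ = trans (lookup∘tabulate _ i)
  (cong (suc ∘ toℕ) (disjoint P _ a i (proj₂ (covering P i)) i∈))

fibre-canonicalForm : ∀ {n} (P : SetPartition n) a → fibre (canonicalForm P) a ≡ blocks P a
fibre-canonicalForm P a = ⊆-antisym
  (λ {i} i∈ → subst (λ b → i ∈ blocks P b)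
    (toℕ-injective (suc-injective
      (trans (sym (lookup∘tabulate _ i)) (∈-fibre⁻ (canonicalForm P) a i∈))))
    (proj₂ (covering P i)))
  (λ i∈ → ∈-fibre⁺ (canonicalForm P) a (lookup-canonicalForm P a i∈))

canonicalForm⇒fibresPartition : ∀ {n} (P : SetPartition n) →
  FibresPartition (canonicalForm P) (size P)
canonicalForm⇒fibresPartition P =
  (λ i → blockOf P i , back _ (proj₂ (covering P i))) ,
  (λ a → proj₁ (nonempty P a) , back a (proj₂ (nonempty P a))) ,
  λ a b a<b i j mi mj → ordered P a b a<b i j
    (subst (i IsMinOf_) (fibre-canonicalForm P a) mi)
    (subst (j IsMinOf_) (fibre-canonicalForm P b) mj)
  where
  back : ∀ a {i} → i ∈ blocks P a → i ∈ fibre (canonicalForm P) a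
  back a {i} = subst (i ∈_) (sym (fibre-canonicalForm P a))

canonical? : ∀ {n} (π : Vec ℕ n) → Dec (IsCanonical π)
canonical? {n} π = map′
  (λ (k , fp) → fibresPartition⇒canonical π fp)
  (λ { (P , refl) → fromℕ< (s≤s (size≤n P)) ,
       subst (FibresPartition π) (sym (Finₚ.toℕ-fromℕ< (s≤s (size≤n P))))
         (canonicalForm⇒fibresPartition P) })
  (any? λ (k : Fin (suc n)) → fibresPartition? π (toℕ k))

words : ∀ {A : Set} → List A → ∀ n → List (Vec A n)
words as zero    = [] ∷ []
words as (suc n) = cartesianProductWith _∷_ as (words as n)

canonicalNonCrossing? : ∀ n (π : Vec ℕ n) → Dec (IsCanonical π × NonCrossing π)
canonicalNonCrossing? n π = canonical? π ×-dec nonCrossing? π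

-- A partition of [n] has at most n blocks, so the letters 1,…,n suffice;
-- see ∈-NC and NC-unique.
NC : ∀ n → List (Vec ℕ n)
NC n = filter (canonicalNonCrossing? n) (words (map suc (upTo n)) n)

∈-words : ∀ {A : Set} (as : List A) {n} (w : Vec A n) → (∀ i → lookup w i ∈ₗ as) → w ∈ₗ words as n
∈-words as []      h = here refl
∈-words as (x ∷ w) h = ∈-cartesianProductWith⁺ _∷_ (h Fin.zero) (∈-words as w (h ∘ Fin.suc))

∈-NC : ∀ {n} (π : Vec ℕ n) → π ∈ₗ NC n ⇔ (IsCanonical π × NonCrossing π)
∈-NC {n} π = mk⇔
  (λ π∈ → proj₂ (∈-filter⁻ (canonicalNonCrossing? n) {v = π} {xs = words (map suc (upTo n)) n} π∈))
  (λ (c , nc) → ∈-filter⁺ (canonicalNonCrossing? n) (∈-words _ π (letter∈ c)) (c , nc))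
  where
  letter∈ : IsCanonical π → ∀ i → lookup π i ∈ₗ map suc (upTo n)
  letter∈ (P , refl) i = subst (_∈ₗ map suc (upTo n)) (sym (lookup∘tabulate _ i))
    (∈-map⁺ suc (∈-upTo⁺ (≤-trans (Finₚ.toℕ<n (blockOf P i)) (size≤n P))))

words-unique : ∀ {A : Set} {as : List A} → Unique as → ∀ n → Unique (words as n)
words-unique u zero    = [] ∷ []
words-unique u (suc n) = Uniqueₚ.cartesianProductWith⁺ _∷_ ∷-injective u (words-unique u n)

NC-unique : ∀ n → Unique (NC n)
NC-unique n = Uniqueₚ.filter⁺ (canonicalNonCrossing? n) (words-unique (Uniqueₚ.map⁺ suc-injective (Uniqueₚ.upTo⁺ n)) n)

OrderIsomorphic : List ℕ → List ℕ → Set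
OrderIsomorphic u v = ∃ λ (eq : length u ≡ length v) → ∀ p q →
  (List.lookup u p < List.lookup u q ⇔ List.lookup v (cast eq p) < List.lookup v (cast eq q)) ×
  (List.lookup u p ≡ List.lookup u q ⇔ List.lookup v (cast eq p) ≡ List.lookup v (cast eq q))

orderIsomorphic? : ∀ u v → Dec (OrderIsomorphic u v)
orderIsomorphic? u v with length u ≟ length v
... | no ¬eq = no (¬eq ∘ proj₁)
... | yes eq = map′ (eq ,_) proj₂ (all? λ p → all? λ q →
  ((_ <? _) ⇔-dec (_ <? _)) ×-dec ((_ ≟ _) ⇔-dec (_ ≟ _)))
  where
  _⇔-dec_ : ∀ {A B : Set} → Dec A → Dec B → Dec (A ⇔ B)
  a ⇔-dec b = map′ (λ (f , g) → mk⇔ f g) (λ e → Equivalence.to e , Equivalence.from e)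
    ((a →-dec b) ×-dec (b →-dec a))

-- Starting positions are 0-based: for |ρ| = n and |τ| = k they range over
-- 0,…,n-k, which is the empty range when k > n.
μ : List ℕ → List ℕ → ℕ
μ τ ρ = length (filter (λ i → orderIsomorphic? (take (length τ) (drop i ρ)) τ)
                       (upTo (suc (length ρ) ∸ length τ)))

totalOccurrences : List ℕ → ℕ → ℕ
totalOccurrences τ n = sum (map (λ π → μ τ (toList π)) (NC n))

-- The patterns 1^m and 1^m 2.
ones : ℕ → List ℕ
ones m = replicate m 1

ones2 : ℕ → List ℕ
ones2 m = ones m ++ (2 ∷ [])

{-# OPTIONS --safe #-}

-- Read a non-crossing canonical form from left to right. A letter is either new, hence
-- one more than the largest letter so far, or a repetition of a letter b after which no
-- smaller letter a has been read: otherwise a b a b occurs, since the first a precedes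
-- the first b. The letters that may still be repeated form a stack with the last letter
-- read on top; a new letter is pushed, a repetition pops down to the repeated letter. So
-- from height h the next height is any of 1,…,h+1, and the number of continuations is a
-- ballot number. A repetition of the top leaves the height unchanged and an ascent is a
-- push, hence an occurrence of 1^m contributes as many words as its remainder has
-- continuations. Summed over all starting positions, both totals satisfy one recurrence,
-- solved in closed form by Pascal's rule.

module Submission where

open import Defs
open import Algebra.Properties.CommutativeSemigroup using (interchange)
open import Data.Bool using (true; false; if_then_else_)
open import Data.Empty using (⊥)
open import Data.Fin as Fin using (Fin; zero; suc; toℕ; fromℕ<; cast)
open import Data.Fin.Properties using (toℕ-fromℕ<; toℕ<n)
import Data.Fin.Subset as Subset
open import Data.Fin.Subset.Properties using (_∈?_)
open import Data.List as List using (List; []; _∷_; _++_; length; map; filter; applyUpTo; upTo; replicate; take; drop)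
open import Data.List.Membership.Propositional using (_∈_)
open import Data.List.Membership.Propositional.Properties using (∈-++⁺ˡ; ∈-++⁺ʳ; ∈-++⁻; ∈-map⁺; ∈-map⁻)
open import Data.List.Membership.Propositional.Properties.WithK using (unique∧set⇒bag)
open import Data.List.Properties using (++-identityʳ; length-take; map-∘; map-cong; map-++; map-upTo)
open import Data.List.Relation.Binary.BagAndSetEquality using (∼bag⇒↭)
open import Data.List.Relation.Binary.Permutation.Propositional using (_↭_)
open import Data.List.Relation.Binary.Permutation.Propositional.Properties using (map⁺)
open import Data.List.Relation.Unary.All as All using (All; []; _∷_)
open import Data.List.Relation.Unary.AllPairs using (AllPairs; []; _∷_)
open import Data.List.Relation.Unary.Any using (here; there)
open import Data.List.Relation.Unary.Unique.Propositional using (Unique)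
import Data.List.Relation.Unary.Unique.Propositional.Properties as Uniqueₚ
open import Data.Nat
open import Data.Nat.Combinatorics using (_C_; nCk≡nC[n∸k]; nCn≡1; nCk+nC[k+1]≡[n+1]C[k+1])
open import Data.Nat.ListAction using (sum)
open import Data.Nat.ListAction.Properties using (sum-++; sum-↭)
open import Data.Nat.Properties
open import Data.Nat.Tactic.RingSolver using (solve-∀)
open import Data.Product using (∃; _×_; _,_; proj₁; proj₂)
open import Data.Sum using (_⊎_; inj₁; inj₂)
open import Data.Vec using (Vec; []; _∷_; lookup; head; toList)
open import Data.Vec.Properties using (∷-injectiveʳ)
open import Function using (_∘_)
open import Function.Bundles using (_⇔_; mk⇔; Equivalence)
open import Relation.Binary.Definitions using (tri<; tri≈; tri>)
open import Relation.Binary.PropositionalEquality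
open import Relation.Nullary using (Dec; yes; no; does; contradiction; ¬_)
open import Relation.Nullary.Decidable using (dec-true; dec-false)
open import Relation.Unary using (Decidable)

-- Generation of non-crossing canonical forms by a stack.

-- The state of a reader of a non-crossing canonical form is the largest letter k
-- so far together with the stack of the letters that may still recur, largest first.
mutual
  continuations : ℕ → List ℕ → ∀ n → List (Vec ℕ n)
  continuations k s zero    = [] ∷ []
  continuations k s (suc n) =
    map (suc k ∷_) (continuations (suc k) (suc k ∷ s) n) ++ recurrences k s n

  recurrences : ℕ → List ℕ → ∀ n → List (Vec ℕ (suc n))
  recurrences k []      n = []
  recurrences k (x ∷ s) n = map (x ∷_) (continuations k (x ∷ s) n) ++ recurrences k s n

-- Prepending `suc k` lets one chain express both that the stack strictly decreases and that its
-- letters are at most `k`.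
Descending : ℕ → List ℕ → Set
Descending k s = AllPairs _>_ (suc k ∷ s)

push : ∀ {k s} → Descending k s → Descending (suc k) (suc k ∷ s)
push ds@(s≤k ∷ _) = (≤-refl ∷ All.map m<n⇒m<1+n s≤k) ∷ ds

pop : ∀ {k x s} → Descending k (x ∷ s) → Descending k s
pop ((_ ∷ s≤k) ∷ _ ∷ ds) = s≤k ∷ ds

-- The suffixes w of non-crossing canonical forms after a prefix that leads to the state (k , s).
record Continues {n} (k : ℕ) (s : List ℕ) (w : Vec ℕ n) : Set where
  constructor continues
  field
    old    : ∀ i → lookup w i ≤ k → lookup w i ∈ s
    new    : ∀ i a → k < a → a < lookup w i → ∃ λ j → j Fin.< i × lookup w j ≡ a
    -- The non-crossing condition: a smaller letter first occurs before a larger one, so a copy of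
    -- the larger letter before `i`, in the prefix or in `w`, would complete a crossing.
    ascent : ∀ i j → i Fin.< j → lookup w i < lookup w j →
             k < lookup w j × (∀ h → h Fin.< i → lookup w h ≢ lookup w j)

open Continues

module _ {n k : ℕ} {s : List ℕ} {w : Vec ℕ n} where

  continues-push⁺ : Continues (suc k) (suc k ∷ s) w → Continues k s (suc k ∷ w)
  continues-push⁺ (continues o f a) = continues o′ f′ a′
    where
    o′ : ∀ i → lookup (suc k ∷ w) i ≤ k → lookup (suc k ∷ w) i ∈ s
    o′ zero    le = contradiction le 1+n≰n
    o′ (suc i) le with o i (m≤n⇒m≤1+n le)
    ... | here eq  = contradiction (subst (_≤ k) eq le) 1+n≰n
    ... | there ∈s = ∈s

    f′ : ∀ i b → k < b → b < lookup (suc k ∷ w) i → ∃ λ j → j Fin.< i × lookup (suc k ∷ w) j ≡ b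
    f′ zero    b k<b b<x = contradiction k<b (<⇒≱ b<x)
    f′ (suc i) b k<b b<x with suc k ≟ b
    ... | yes eq = zero , z<s , eq
    ... | no neq with f i b (≤∧≢⇒< k<b neq) b<x
    ...   | j , j<i , eq = suc j , s<s j<i , eq

    a′ : ∀ i j → i Fin.< j → lookup (suc k ∷ w) i < lookup (suc k ∷ w) j →
         k < lookup (suc k ∷ w) j × (∀ h → h Fin.< i → lookup (suc k ∷ w) h ≢ lookup (suc k ∷ w) j)
    a′ zero    (suc j) _         x<y = <-trans ≤-refl x<y , λ _ ()
    a′ (suc i) (suc j) (s<s i<j) x<y with a i j i<j x<y
    ... | k<y , fresh = <-trans ≤-refl k<y , λ
      { zero    _         → <⇒≢ k<y
      ; (suc h) (s<s h<i) → fresh h h<i }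

  continues-push⁻ : Continues k s (suc k ∷ w) → Continues (suc k) (suc k ∷ s) w
  continues-push⁻ (continues o f a) = continues o′ f′ λ i j i<j x<y →
      -- The larger letter differs from the `suc k` at position `zero`, which sharpens its bound
      -- from `k` to `suc k`.
      ≤∧≢⇒< (proj₁ (a (suc i) (suc j) (s<s i<j) x<y)) (proj₂ (a (suc i) (suc j) (s<s i<j) x<y) zero z<s) ,
      λ h h<i → proj₂ (a (suc i) (suc j) (s<s i<j) x<y) (suc h) (s<s h<i)
    where
    o′ : ∀ i → lookup w i ≤ suc k → lookup w i ∈ suc k ∷ s
    o′ i le with m≤n⇒m<n∨m≡n le
    ... | inj₁ (s≤s le′) = there (o (suc i) le′)
    ... | inj₂ eq        = here eq

    f′ : ∀ i b → suc k < b → b < lookup w i → ∃ λ j → j Fin.< i × lookup w j ≡ b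
    f′ i b k<b b<x with f (suc i) b (<-trans ≤-refl k<b) b<x
    ... | zero  , _       , eq = contradiction eq (<⇒≢ k<b)
    ... | suc j , s<s j<i , eq = j , j<i , eq

  continues-weaken : ∀ {x} → Continues k s w → Continues k (x ∷ s) w
  continues-weaken (continues o f a) = continues (λ i le → there (o i le)) f a

module _ {n k x : ℕ} {s : List ℕ} {w : Vec ℕ n} where

  continues-stay⁺ : Descending k (x ∷ s) → Continues k (x ∷ s) w → Continues k (x ∷ s) (x ∷ w)
  continues-stay⁺ ((s≤s x≤k ∷ _) ∷ s<x ∷ _) (continues o f a) = continues o′ f′ a′
    where
    o′ : ∀ i → lookup (x ∷ w) i ≤ k → lookup (x ∷ w) i ∈ x ∷ s
    o′ zero    _  = here refl
    o′ (suc i) le = o i le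

    f′ : ∀ i b → k < b → b < lookup (x ∷ w) i → ∃ λ j → j Fin.< i × lookup (x ∷ w) j ≡ b
    f′ zero    b k<b b<x = contradiction x≤k (<⇒≱ (<-trans k<b b<x))
    f′ (suc i) b k<b b<y with f i b k<b b<y
    ... | j , j<i , eq = suc j , s<s j<i , eq

    a′ : ∀ i j → i Fin.< j → lookup (x ∷ w) i < lookup (x ∷ w) j →
         k < lookup (x ∷ w) j × (∀ h → h Fin.< i → lookup (x ∷ w) h ≢ lookup (x ∷ w) j)
    -- If the later letter were at most `k`, then `old` would put it on the stack, where nothing
    -- exceeds `x`.
    a′ zero (suc j) _ x<y with k <? lookup w j
    ... | yes k<y = k<y , λ _ ()
    ... | no  k≮y with o j (≮⇒≥ k≮y)
    ...   | here eq  = contradiction (sym eq) (<⇒≢ x<y)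
    ...   | there ∈s = contradiction x<y (<-asym (All.lookup s<x ∈s))
    a′ (suc i) (suc j) (s<s i<j) y<z with a i j i<j y<z
    ... | k<z , fresh = k<z , λ
      { zero    _         → <⇒≢ (≤-<-trans x≤k k<z)
      ; (suc h) (s<s h<i) → fresh h h<i }

  continues-stay⁻ : Descending k (x ∷ s) → Continues k (x ∷ s) (x ∷ w) → Continues k (x ∷ s) w
  continues-stay⁻ ((s≤s x≤k ∷ _) ∷ _) (continues o f a) = continues (o ∘ suc) f′ λ i j i<j y<z →
      proj₁ (a (suc i) (suc j) (s<s i<j) y<z) ,
      λ h h<i → proj₂ (a (suc i) (suc j) (s<s i<j) y<z) (suc h) (s<s h<i)
    where
    f′ : ∀ i b → k < b → b < lookup w i → ∃ λ j → j Fin.< i × lookup w j ≡ b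
    f′ i b k<b b<y with f (suc i) b k<b b<y
    ... | zero  , _       , eq = contradiction (subst (_≤ k) eq x≤k) (<⇒≱ k<b)
    ... | suc j , s<s j<i , eq = j , j<i , eq

  -- Once `x` below the top `y` has been read, `y` cannot recur: that would be an ascent to a letter
  -- at most `k`.
  continues-pop : ∀ {y} → Descending k (y ∷ s) → x ∈ s → Continues k (y ∷ s) (x ∷ w) → Continues k s (x ∷ w)
  continues-pop {y} ((s≤s y≤k ∷ _) ∷ s<y ∷ _) x∈s (continues o f a) = continues o′ f a
    where
    o′ : ∀ i → lookup (x ∷ w) i ≤ k → lookup (x ∷ w) i ∈ s
    o′ zero    _  = x∈s
    o′ (suc i) le with o (suc i) le
    ... | there ∈s = ∈s
    ... | here eq  = contradiction le
      (<⇒≱ (proj₁ (a zero (suc i) z<s (subst (x <_) (sym eq) (All.lookup s<y x∈s)))))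

continues-head : ∀ {n k s x} {w : Vec ℕ n} → Continues k s (x ∷ w) → x ≡ suc k ⊎ x ∈ s
continues-head {k = k} {x = x} (continues o f _) with <-cmp x (suc k)
... | tri< (s≤s x≤k) _ _ = inj₂ (o zero x≤k)
... | tri≈ _ eq _ = inj₁ eq
-- A first letter above `suc k` would need `suc k` at an earlier position.
... | tri> _ _ k<x with f zero (suc k) ≤-refl k<x
...   | _ , () , _

-- Soundness, completeness and absence of duplicates in the generation.

mutual
  continuations-sound : ∀ {n k s} {w : Vec ℕ n} → Descending k s → w ∈ continuations k s n → Continues k s w
  continuations-sound {zero} {w = []} _ _ = continues (λ ()) (λ ()) λ ()
  continuations-sound {suc n} {k} {s} ds w∈
    with ∈-++⁻ (map (suc k ∷_) (continuations (suc k) (suc k ∷ s) n)) w∈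
  ... | inj₂ w∈′ = recurrences-sound ds w∈′
  ... | inj₁ w∈′ with ∈-map⁻ (suc k ∷_) w∈′
  ...   | v , v∈ , refl = continues-push⁺ (continuations-sound (push ds) v∈)

  recurrences-sound : ∀ {n k s} {w : Vec ℕ (suc n)} → Descending k s → w ∈ recurrences k s n → Continues k s w
  recurrences-sound {n} {k} {x ∷ s} ds w∈ with ∈-++⁻ (map (x ∷_) (continuations k (x ∷ s) n)) w∈
  ... | inj₂ w∈′ = continues-weaken (recurrences-sound (pop ds) w∈′)
  ... | inj₁ w∈′ with ∈-map⁻ (x ∷_) w∈′
  ...   | v , v∈ , refl = continues-stay⁺ ds (continuations-sound ds v∈)

mutual
  continuations-complete : ∀ {n k s} {w : Vec ℕ n} → Descending k s → Continues k s w → w ∈ continuations k s n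
  continuations-complete {w = []} _ _ = here refl
  continuations-complete {k = k} {s} {w = x ∷ w} ds c with continues-head c
  ... | inj₁ refl = ∈-++⁺ˡ (∈-map⁺ (suc k ∷_) (continuations-complete (push ds) (continues-push⁻ c)))
  ... | inj₂ x∈s  = ∈-++⁺ʳ _ (recurrences-complete ds x∈s c)

  recurrences-complete : ∀ {n k s x} {w : Vec ℕ n} → Descending k s → x ∈ s →
                         Continues k s (x ∷ w) → x ∷ w ∈ recurrences k s n
  recurrences-complete {s = y ∷ s} ds (here refl) c =
    ∈-++⁺ˡ (∈-map⁺ (y ∷_) (continuations-complete ds (continues-stay⁻ ds c)))
  recurrences-complete {s = y ∷ s} ds (there x∈s) c =
    ∈-++⁺ʳ _ (recurrences-complete (pop ds) x∈s (continues-pop ds x∈s c))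

head-recurrences : ∀ {n k} s {w : Vec ℕ (suc n)} → w ∈ recurrences k s n → head w ∈ s
head-recurrences {n} {k} (x ∷ s) w∈ with ∈-++⁻ (map (x ∷_) (continuations k (x ∷ s) n)) w∈
... | inj₂ w∈′ = there (head-recurrences s w∈′)
... | inj₁ w∈′ with ∈-map⁻ (x ∷_) w∈′
...   | _ , _ , refl = here refl

-- The two lists are told apart by first letters, as `x` exceeds every letter of `s`.
unique-letters : ∀ {n x s} {ws : List (Vec ℕ n)} {vs} → All (x >_) s → Unique ws → Unique vs →
                 (∀ {v} → v ∈ vs → head v ∈ s) → Unique (map (x ∷_) ws ++ vs)
unique-letters {x = x} {s} {ws} {vs} s<x uw uv hd = Uniqueₚ.++⁺ (Uniqueₚ.map⁺ ∷-injectiveʳ uw) uv disjoint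
  where
  disjoint : ∀ {v} → v ∈ map (x ∷_) ws × v ∈ vs → ⊥
  disjoint (v∈ , v∈vs) with ∈-map⁻ (x ∷_) v∈
  ... | _ , _ , refl = <-irrefl refl (All.lookup s<x (hd v∈vs))

mutual
  continuations-unique : ∀ {k s} n → Descending k s → Unique (continuations k s n)
  continuations-unique zero _ = [] ∷ []
  continuations-unique {s = s} (suc n) ds@(s≤k ∷ _) =
    unique-letters s≤k (continuations-unique n (push ds)) (recurrences-unique n ds) (head-recurrences s)

  recurrences-unique : ∀ {k s} n → Descending k s → Unique (recurrences k s n)
  recurrences-unique {s = []} n _ = []
  recurrences-unique {s = x ∷ s} n ds@(_ ∷ s<x ∷ _) =
    unique-letters s<x (continuations-unique n ds) (recurrences-unique n (pop ds)) (head-recurrences s)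

-- Identification with the members of `NC n`.

-- `MinIncreasing` speaks only of block minima, so these must be found before it can be applied.
least : ∀ {n} {P : Fin n → Set} → Decidable P → ∃ P → ∃ λ i → P i × (∀ j → P j → i Fin.≤ j)
least {zero}  P? (() , _)
least {suc n} P? (i , p) with P? zero
... | yes p₀ = zero , p₀ , λ _ _ → z≤n
... | no ¬p₀ with i
...   | zero = contradiction p ¬p₀
...   | suc i′ with least (P? ∘ suc) (i′ , p)
...     | j , q , min = suc j , q , λ
  { zero    p₀ → contradiction p₀ ¬p₀
  ; (suc l) pl → s≤s (min l pl) }

-- The maximum serves as the number of blocks. Its attainment is phrased through smaller `a` so as
-- to hold for the empty word, with `k` equal to 0.
maximum : ∀ {n} (w : Vec ℕ n) → ∃ λ k →
  (∀ i → lookup w i ≤ k) × (∀ a → a < k → ∃ λ i → a < lookup w i)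
maximum []      = 0 , (λ ()) , λ _ ()
maximum (x ∷ w) with maximum w
... | k , ub , att with ≤-total x k
...   | inj₁ x≤k = k , (λ { zero → x≤k ; (suc i) → ub i }) ,
        λ a a<k → suc (proj₁ (att a a<k)) , proj₂ (att a a<k)
...   | inj₂ k≤x = x , (λ { zero → ≤-refl ; (suc i) → ≤-trans (ub i) k≤x }) , λ a a<x → zero , a<x

-- From the empty state, `old` says that letters are positive, `new` is restricted growth, which
-- amounts to increasing block minima, and `ascent` excludes crossings.
continues⇔canonicalNonCrossing : ∀ {n} (π : Vec ℕ n) →
  Continues 0 [] π ⇔ (IsCanonical π × NonCrossing π)
continues⇔canonicalNonCrossing {n} π = mk⇔
  (λ c → fibresPartition⇒canonical π (fibres c) , nonCrossing c)
  λ { (can , nc) → fromCanonical can nc }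
  where
  module _ (c : Continues 0 [] π) where
    nonCrossing : NonCrossing π
    nonCrossing (i , j , k , l , i<j , j<k , k<l , ik , jl , a<b) =
      -- The last two letters of a b a b form an ascent to b, which has already occurred at `j`.
      proj₂ (ascent c k l k<l (subst₂ _<_ ik jl a<b)) j j<k jl

    positive : ∀ i → 0 < lookup π i
    positive i with 0 <? lookup π i
    ... | yes p = p
    ... | no ¬p with old c i (≮⇒≥ ¬p)
    ...   | ()

    earlier : ∀ i a → 0 < a → a ≤ lookup π i → ∃ λ j → j Fin.≤ i × lookup π j ≡ a
    earlier i a 0<a a≤ with m≤n⇒m<n∨m≡n a≤
    ... | inj₂ eq = i , ≤-refl , sym eq
    ... | inj₁ a< with new c i a 0<a a<
    ...   | j , j<i , eq = j , <⇒≤ j<i , eq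

    k = proj₁ (maximum π)

    fibres : FibresPartition π k
    fibres = cov , ne , ord
      where
      cov : ∀ i → ∃ λ (a : Fin k) → i Subset.∈ fibre π a
      cov i = a , ∈-fibre⁺ π a (trans (sym (m∸n+n≡m (positive i)))
          (trans (+-comm _ 1) (cong suc (sym (toℕ-fromℕ< lt)))))
        where
        lt : lookup π i ∸ 1 < k
        lt = <-≤-trans (≤-reflexive (trans (+-comm 1 _) (m∸n+n≡m (positive i)))) (proj₁ (proj₂ (maximum π)) i)
        a = fromℕ< lt
      ne : ∀ (a : Fin k) → Subset.Nonempty (fibre π a)
      ne a with proj₂ (proj₂ (maximum π)) (toℕ a) (toℕ<n a)
      ... | i , a<πi with earlier i (suc (toℕ a)) z<s a<πi
      ...   | j , _ , eq = j , ∈-fibre⁺ π a eq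
      ord : MinIncreasing (fibre π {k})
      ord a b a<b i j (_ , min) (j∈ , _)
        with new c j (suc (toℕ a)) z<s (subst (suc (toℕ a) <_) (sym (∈-fibre⁻ π b j∈)) (s<s a<b))
      ... | l , l<j , eq = ≤-<-trans (min l (∈-fibre⁺ π a eq)) l<j

  module _ {k : ℕ} (fp : FibresPartition π k) where
    private
      cov = proj₁ fp
      ne  = proj₁ (proj₂ fp)
      ord = proj₂ (proj₂ fp)

    fill : ∀ i a → 0 < a → a < lookup π i → ∃ λ j → j Fin.< i × lookup π j ≡ a
    fill i (suc a) _ a<πi =
      proj₁ ma , i<j , trans (∈-fibre⁻ π a′ (proj₁ (proj₂ ma))) (cong suc (toℕ-fromℕ< a<k))
      where
      b   = proj₁ (cov i)
      πi  = ∈-fibre⁻ π b (proj₂ (cov i))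
      a<b : a < toℕ b
      a<b = s<s⁻¹ (subst (suc a <_) πi a<πi)
      a<k = <-trans a<b (toℕ<n b)
      a′  = fromℕ< a<k
      ma  = least (_∈? fibre π a′) (ne a′)
      mb  = least (_∈? fibre π b) (i , proj₂ (cov i))
      -- The minimum of the smaller block precedes the minimum of the block of `i`, which is at most
      -- `i`.
      i<j = <-≤-trans (ord a′ b (subst (_< toℕ b) (sym (toℕ-fromℕ< a<k)) a<b) _ _ (proj₂ ma) (proj₂ mb))
                      (proj₂ (proj₂ mb) i (proj₂ (cov i)))

    fromFibres : NonCrossing π → Continues 0 [] π
    fromFibres nc = continues (λ i le → contradiction le (<⇒≱ (letters-positive i))) fill λ i j i<j x<y →
        ≤-<-trans z≤n x<y ,
        λ h h<i eq → crossing i j h i<j h<i x<y eq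
      where
      letters-positive : ∀ i → 0 < lookup π i
      letters-positive i = subst (0 <_) (sym (∈-fibre⁻ π _ (proj₂ (cov i)))) z<s
      crossing : ∀ i j h → i Fin.< j → h Fin.< i → lookup π i < lookup π j → lookup π h ≡ lookup π j → ⊥
      crossing i j h i<j h<i x<y eq
        -- The smaller letter also occurs at some `g` before `h`, so `g`, `h`, `i`, `j` form a
        -- crossing.
        with fill h (lookup π i) (letters-positive i) (subst (lookup π i <_) (sym eq) x<y)
      ... | g , g<h , gi = nc (g , h , i , j , g<h , h<i , i<j , gi , eq , subst₂ _<_ (sym gi) (sym eq) x<y)

  fromCanonical : IsCanonical π → NonCrossing π → Continues 0 [] π
  fromCanonical (P , refl) = fromFibres (canonicalForm⇒fibresPartition P)

NC-↭-continuations : ∀ n → NC n ↭ continuations 0 [] n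
NC-↭-continuations n = ∼bag⇒↭ (unique∧set⇒bag (NC-unique n) (continuations-unique n empty) λ {π} →
  mk⇔ (continuations-complete empty ∘ from (continues⇔canonicalNonCrossing π) ∘ to (∈-NC π))
      (from (∈-NC π) ∘ to (continues⇔canonicalNonCrossing π) ∘ continuations-sound empty))
  where
  open Equivalence
  empty : Descending 0 []
  empty = [] ∷ []

-- Ballot numbers and closed forms of the recurrences.

-- Summation starts at 1 because the stack is never empty after a letter has been read.
Σ≤ : ℕ → (ℕ → ℕ) → ℕ
Σ≤ zero    f = 0
Σ≤ (suc h) f = f (suc h) + Σ≤ h f

Σ≤-cong : ∀ h {f g : ℕ → ℕ} → (∀ j → f j ≡ g j) → Σ≤ h f ≡ Σ≤ h g
Σ≤-cong zero    eq = refl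
Σ≤-cong (suc h) eq = cong₂ _+_ (eq (suc h)) (Σ≤-cong h eq)

-- The number of continuations of length n from a stack of height h.
ballot : ℕ → ℕ → ℕ
ballot h zero    = 1
ballot h (suc n) = Σ≤ (suc h) λ j → ballot j n

-- The number of pairs of a continuation of length n + c and one of its first n positions whose
-- letter is followed by c pushes; c is 0 for the pattern 1^m and 1 for 1^m 2.
risers : ℕ → ℕ → ℕ → ℕ
risers c h zero    = 0
risers c h (suc n) = Σ≤ (suc h) λ j → ballot (c + j) n + risers c j n

-- The binomial coefficient with lower index `k - 1`, equal to 0 at `k = 0`, where `N C (k ∸ 1)`
-- would be 1.
_C⁻_ : ℕ → ℕ → ℕ
N C⁻ zero  = 0
N C⁻ suc k = N C k

nC0≡1 : ∀ n → n C 0 ≡ 1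
nC0≡1 n = trans (nCk≡nC[n∸k] {0} {n} z≤n) (nCn≡1 n)

pascal⁻ : ∀ N k → suc N C⁻ suc k ≡ N C⁻ k + N C⁻ suc k
pascal⁻ N zero    = trans (nC0≡1 (suc N)) (sym (nC0≡1 N))
pascal⁻ N (suc k) = sym (nCk+nC[k+1]≡[n+1]C[k+1] N k)

pascal : ∀ N k → suc N C suc k ≡ N C k + N C suc k
pascal N k = sym (nCk+nC[k+1]≡[n+1]C[k+1] N k)

C-sym : ∀ j k → (j + k) C j ≡ (j + k) C k
C-sym j k = trans (nCk≡nC[n∸k] (m≤m+n j k)) (cong ((j + k) C_) (m+n∸m≡n j k))

-- The ballot number is a difference of neighbouring binomial coefficients, written additively to
-- avoid truncated subtraction. Splitting off the top summand, height `suc (suc h)`, leaves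
-- `ballot h (suc n)`, which matches Pascal's rule.
ballot-C : ∀ n h → ballot h n + (h + 2 * n) C⁻ n ≡ (h + 2 * n) C n
ballot-C zero h = sym (nC0≡1 (h + 0))
ballot-C (suc n) zero = begin
  ballot 1 n + 0 + (2 * suc n) C⁻ suc n
    ≡⟨ cong₂ _+_ (+-identityʳ _) (trans (cong (_C⁻ suc n) N≡) (pascal⁻ (1 + 2 * n) n)) ⟩
  ballot 1 n + ((1 + 2 * n) C⁻ n + (1 + 2 * n) C n)
    ≡⟨ +-assoc (ballot 1 n) _ _ ⟨
  ballot 1 n + (1 + 2 * n) C⁻ n + (1 + 2 * n) C n
    ≡⟨ cong (_+ (1 + 2 * n) C n) (ballot-C n 1) ⟩
  (1 + 2 * n) C n + (1 + 2 * n) C n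
    ≡⟨ cong ((1 + 2 * n) C n +_) middle ⟩
  (1 + 2 * n) C n + (1 + 2 * n) C suc n
    ≡⟨ trans (cong (_C suc n) N≡) (pascal (1 + 2 * n) n) ⟨
  (2 * suc n) C suc n ∎
  where
  open ≡-Reasoning
  N≡ : 2 * suc n ≡ suc (1 + 2 * n)
  N≡ = *-suc 2 n
  -- Height 0 leaves no second ballot number; equality of the two central entries of an odd row
  -- takes its place.
  middle : (1 + 2 * n) C n ≡ (1 + 2 * n) C suc n
  middle = trans (cong (_C n) n+[1+n]) (trans (C-sym n (suc n)) (cong (_C suc n) (sym n+[1+n])))
    where
    n+[1+n] : 1 + 2 * n ≡ n + suc n
    n+[1+n] = trans (cong (λ x → suc (n + x)) (+-identityʳ n)) (sym (+-suc n n))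
ballot-C (suc n) (suc h) = begin
  ballot (suc (suc h)) n + ballot h (suc n) + (suc N C⁻ suc n)
    ≡⟨ cong (ballot (suc (suc h)) n + ballot h (suc n) +_) (pascal⁻ N n) ⟩
  ballot (suc (suc h)) n + ballot h (suc n) + (N C⁻ n + N C⁻ suc n)
    ≡⟨ interchange +-commutativeSemigroup (ballot (suc (suc h)) n) _ _ _ ⟩
  (ballot (suc (suc h)) n + N C⁻ n) + (ballot h (suc n) + N C⁻ suc n)
    ≡⟨ cong₂ _+_ (subst (λ M → ballot (suc (suc h)) n + M C⁻ n ≡ M C n) (shift h n) (ballot-C n (suc (suc h))))
                 (ballot-C (suc n) h) ⟩
  N C n + N C suc n
    ≡⟨ pascal N n ⟨
  suc N C suc n ∎
  where
  open ≡-Reasoning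
  N = h + 2 * suc n
  shift : ∀ h n → suc (suc h) + 2 * n ≡ h + 2 * suc n
  shift = solve-∀

-- The ballot numbers enter the recurrence of risers as the difference of consecutive
-- binomial coefficients, which Pascal's rule absorbs into the factor suc h.
risers-C : ∀ c n h → risers c h n ≡ suc h * ((c + h + 2 * n) C⁻ n)
risers-C c zero    h    = sym (*-zeroʳ (suc h))
risers-C c (suc n) zero = begin
  ballot (c + 1) n + risers c 1 n + 0
    ≡⟨ +-identityʳ _ ⟩
  ballot (c + 1) n + risers c 1 n
    ≡⟨ cong (ballot (c + 1) n +_) (risers-C c n 1) ⟩
  ballot (c + 1) n + 2 * (M C⁻ n)
    ≡⟨ split (ballot (c + 1) n) (M C⁻ n) ⟩
  (ballot (c + 1) n + M C⁻ n) + M C⁻ n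
    ≡⟨ cong (_+ M C⁻ n) (ballot-C n (c + 1)) ⟩
  M C n + M C⁻ n
    ≡⟨ +-comm (M C n) _ ⟩
  M C⁻ n + M C n
    ≡⟨ trans (cong (_C⁻ suc n) (shift c n)) (pascal⁻ M n) ⟨
  (c + 0 + 2 * suc n) C⁻ suc n
    ≡⟨ +-identityʳ _ ⟨
  1 * ((c + 0 + 2 * suc n) C⁻ suc n) ∎
  where
  open ≡-Reasoning
  M = c + 1 + 2 * n
  split : ∀ b x → b + 2 * x ≡ (b + x) + x
  split = solve-∀
  shift : ∀ c n → c + 0 + 2 * suc n ≡ suc (c + 1 + 2 * n)
  shift = solve-∀
risers-C c (suc n) (suc h) = begin
  ballot (c + suc (suc h)) n + risers c (suc (suc h)) n + risers c h (suc n)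
    ≡⟨ cong₂ (λ x y → ballot (c + suc (suc h)) n + x + y) (risers-C c n (suc (suc h))) (risers-C c (suc n) h) ⟩
  ballot (c + suc (suc h)) n + (3 + h) * (M C⁻ n) + (1 + h) * ((c + h + 2 * suc n) C⁻ suc n)
    ≡⟨ cong (λ N → ballot (c + suc (suc h)) n + (3 + h) * (M C⁻ n) + (1 + h) * (N C n)) (shift c h n) ⟩
  ballot (c + suc (suc h)) n + (3 + h) * (M C⁻ n) + (1 + h) * (M C n)
    ≡⟨ split (ballot (c + suc (suc h)) n) (M C⁻ n) (M C n) h ⟩
  (ballot (c + suc (suc h)) n + M C⁻ n) + ((2 + h) * (M C⁻ n) + (1 + h) * (M C n))
    ≡⟨ cong (_+ ((2 + h) * (M C⁻ n) + (1 + h) * (M C n))) (ballot-C n (c + suc (suc h))) ⟩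
  M C n + ((2 + h) * (M C⁻ n) + (1 + h) * (M C n))
    ≡⟨ collect (M C⁻ n) (M C n) h ⟩
  (2 + h) * (M C⁻ n + M C n)
    ≡⟨ cong ((2 + h) *_) (trans (cong (_C⁻ suc n) (shift₂ c h n)) (pascal⁻ M n)) ⟨
  (2 + h) * ((c + suc h + 2 * suc n) C⁻ suc n) ∎
  where
  open ≡-Reasoning
  M = c + suc (suc h) + 2 * n
  shift : ∀ c h n → c + h + 2 * suc n ≡ c + suc (suc h) + 2 * n
  shift = solve-∀
  shift₂ : ∀ c h n → c + suc h + 2 * suc n ≡ suc (c + suc (suc h) + 2 * n)
  shift₂ = solve-∀
  split : ∀ b x y h → b + (3 + h) * x + (1 + h) * y ≡ (b + x) + ((2 + h) * x + (1 + h) * y)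
  split = solve-∀
  collect : ∀ x y h → y + ((2 + h) * x + (1 + h) * y) ≡ (2 + h) * (x + y)
  collect = solve-∀

r+1+1≡2+r : ∀ r → r + 1 + 1 ≡ 2 + r
r+1+1≡2+r = solve-∀

-- Here `r` is n - m, so `r + 1` is the r of the theorem. Symmetry of the row exchanges the lower
-- indices `r` and `2 + r`.
risers₀ : ∀ r → risers 0 0 (suc r) ≡ (2 * (r + 1)) C (r + 1 + 1)
risers₀ r = begin
  risers 0 0 (suc r)    ≡⟨ trans (risers-C 0 (suc r) 0) (+-identityʳ _) ⟩
  (2 * suc r) C r       ≡⟨ cong (_C r) (shift r) ⟩
  (r + (2 + r)) C r     ≡⟨ C-sym r (2 + r) ⟩
  (r + (2 + r)) C (2 + r) ≡⟨ cong₂ _C_ (trans (cong (2 *_) (+-comm r 1)) (shift r)) (r+1+1≡2+r r) ⟨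
  (2 * (r + 1)) C (r + 1 + 1) ∎
  where
  open ≡-Reasoning
  shift : ∀ r → 2 * suc r ≡ r + (2 + r)
  shift = solve-∀

risers₁ : ∀ r → risers 1 0 r ≡ (2 * (r + 1) ∸ 1) C (r + 1 + 1)
-- For n = m the pattern 1^m 2 does not fit, and `1 C 2` is 0 as well.
risers₁ zero    = refl
risers₁ (suc r) = begin
  risers 1 0 (suc r)      ≡⟨ trans (risers-C 1 (suc r) 0) (+-identityʳ _) ⟩
  (1 + 2 * suc r) C r     ≡⟨ cong (_C r) (shift r) ⟩
  (r + (3 + r)) C r       ≡⟨ C-sym r (3 + r) ⟩
  (r + (3 + r)) C (3 + r) ≡⟨ cong₂ _C_ (trans (cong (_∸ 1) (shift₂ r)) (shift r)) (r+1+1≡2+r (suc r)) ⟨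
  (2 * (suc r + 1) ∸ 1) C (suc r + 1 + 1) ∎
  where
  open ≡-Reasoning
  shift : ∀ r → 1 + 2 * suc r ≡ r + (3 + r)
  shift = solve-∀
  shift₂ : ∀ r → 2 * (suc r + 1) ≡ suc (1 + 2 * suc r)
  shift₂ = solve-∀

-- Occurrences at the first position of a word.

indicator : ∀ {A : Set} → Dec A → ℕ
indicator d = if does d then 1 else 0

indicator-yes : ∀ {A : Set} (d : Dec A) → A → indicator d ≡ 1
indicator-yes d a = cong (if_then 1 else 0) (dec-true d a)

indicator-no : ∀ {A : Set} (d : Dec A) → ¬ A → indicator d ≡ 0
indicator-no d ¬a = cong (if_then 1 else 0) (dec-false d ¬a)

indicator-cong : ∀ {A B : Set} (d : Dec A) (e : Dec B) → A ⇔ B → indicator d ≡ indicator e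
indicator-cong d (yes b) eq = indicator-yes d (Equivalence.from eq b)
indicator-cong d (no ¬b) eq = indicator-no d (¬b ∘ Equivalence.to eq)

occursAt? : ∀ τ ρ i → Dec (OrderIsomorphic (take (length τ) (drop i ρ)) τ)
occursAt? τ ρ i = orderIsomorphic? (take (length τ) (drop i ρ)) τ

starts : List ℕ → List ℕ → ℕ
starts τ ρ = indicator (occursAt? τ ρ 0)

starts-yes : ∀ τ ρ → OrderIsomorphic (take (length τ) ρ) τ → starts τ ρ ≡ 1
starts-yes τ ρ = indicator-yes (occursAt? τ ρ 0)

starts-no : ∀ τ ρ → ¬ OrderIsomorphic (take (length τ) ρ) τ → starts τ ρ ≡ 0
starts-no τ ρ = indicator-no (occursAt? τ ρ 0)

-- Doubling the first letter on both sides adds no new comparison: each one pulls back along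
-- `merge`. This strips a run of equal letters one at a time.
OrderIsomorphic-repeat : ∀ x z u v → OrderIsomorphic (x ∷ x ∷ u) (z ∷ z ∷ v) ⇔ OrderIsomorphic (x ∷ u) (z ∷ v)
OrderIsomorphic-repeat x z u v = mk⇔
  (λ (eq , iso) → suc-injective eq , λ p q → iso (suc p) (suc q))
  (λ (eq , iso) → cong suc eq , λ p q →
    subst₂ (λ a b → Agree a (List.lookup (x ∷ x ∷ u) q) b (List.lookup (z ∷ z ∷ v) (cast (cong suc eq) q)))
      (left p) (right eq p)
      (subst₂ (λ a b → Agree (List.lookup (x ∷ u) (merge p)) a (List.lookup (z ∷ v) (cast eq (merge p))) b)
        (left q) (right eq q)
        (iso (merge p) (merge q))))
  where
  Agree : ℕ → ℕ → ℕ → ℕ → Set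
  Agree a a′ b b′ = (a < a′ ⇔ b < b′) × (a ≡ a′ ⇔ b ≡ b′)

  merge : ∀ {n} → Fin (suc (suc n)) → Fin (suc n)
  merge zero    = zero
  merge (suc i) = i

  left : ∀ p → List.lookup (x ∷ u) (merge p) ≡ List.lookup (x ∷ x ∷ u) p
  left zero    = refl
  left (suc p) = refl

  right : (eq : length (x ∷ u) ≡ length (z ∷ v)) → ∀ p →
          List.lookup (z ∷ v) (cast eq (merge p)) ≡ List.lookup (z ∷ z ∷ v) (cast (cong suc eq) p)
  right eq zero    = refl
  right eq (suc p) = refl

OrderIsomorphic-≡ : ∀ {x y z u v} → OrderIsomorphic (x ∷ y ∷ u) (z ∷ z ∷ v) → x ≡ y
OrderIsomorphic-≡ (eq , iso) = Equivalence.from (proj₂ (iso zero (suc zero))) refl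

OrderIsomorphic-1 : ∀ x → OrderIsomorphic (x ∷ []) (1 ∷ [])
OrderIsomorphic-1 x = refl , λ
  { zero zero → irreflexive , mk⇔ (λ _ → refl) (λ _ → refl) }
  where
  irreflexive : x < x ⇔ 1 < 1
  irreflexive = mk⇔ (λ lt → contradiction lt 1+n≰n) (λ lt → contradiction lt 1+n≰n)

OrderIsomorphic-12⁺ : ∀ {x y} → x < y → OrderIsomorphic (x ∷ y ∷ []) (1 ∷ 2 ∷ [])
OrderIsomorphic-12⁺ x<y = refl , λ
  { zero       zero       → irreflexive , mk⇔ (λ _ → refl) (λ _ → refl)
  ; zero       (suc zero) → mk⇔ (λ _ → ≤-refl) (λ _ → x<y) ,
                            mk⇔ (λ eq → contradiction eq (<⇒≢ x<y)) (λ ())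
  ; (suc zero) zero       → mk⇔ (λ y<x → contradiction y<x (<-asym x<y)) (λ { (s<s ()) }) ,
                            mk⇔ (λ eq → contradiction (sym eq) (<⇒≢ x<y)) (λ ())
  ; (suc zero) (suc zero) → irreflexive , mk⇔ (λ _ → refl) (λ _ → refl) }
  where
  irreflexive : ∀ {a b} → a < a ⇔ b < b
  irreflexive = mk⇔ (λ lt → contradiction lt 1+n≰n) (λ lt → contradiction lt 1+n≰n)

OrderIsomorphic-12⁻ : ∀ {x y} → OrderIsomorphic (x ∷ y ∷ []) (1 ∷ 2 ∷ []) → x < y
OrderIsomorphic-12⁻ (eq , iso) = Equivalence.from (proj₁ (iso zero (suc zero))) ≤-refl

starts-repeat : ∀ z v x w → starts (z ∷ z ∷ v) (x ∷ x ∷ w) ≡ starts (z ∷ v) (x ∷ w)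
starts-repeat z v x w = indicator-cong (orderIsomorphic? _ _) (orderIsomorphic? _ _)
  (OrderIsomorphic-repeat x z (take (length v) w) v)

starts-≢ : ∀ z v {x y} w → x ≢ y → starts (z ∷ z ∷ v) (x ∷ y ∷ w) ≡ 0
starts-≢ z v {x} {y} w x≢y = starts-no (z ∷ z ∷ v) (x ∷ y ∷ w) (x≢y ∘ OrderIsomorphic-≡)

count-∷ : ∀ {A : Set} {P : A → Set} (P? : Decidable P) x xs →
          length (filter P? (x ∷ xs)) ≡ indicator (P? x) + length (filter P? xs)
count-∷ P? x xs with does (P? x)
... | true  = refl
... | false = refl

count-map : ∀ {A B : Set} {P : B → Set} (P? : Decidable P) (f : A → B) xs →
            length (filter P? (map f xs)) ≡ length (filter (P? ∘ f) xs)
count-map P? f []       = refl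
count-map P? f (x ∷ xs) = trans (count-∷ P? (f x) (map f xs))
  (trans (cong (indicator (P? (f x)) +_) (count-map P? f xs)) (sym (count-∷ (P? ∘ f) x xs)))

-- Position 0 is split off and the others shift by one. If the pattern is longer than `x ∷ ρ`, both
-- ranges are empty, and the window at 0 is too short to match.
μ-∷ : ∀ z τ x ρ → μ (z ∷ τ) (x ∷ ρ) ≡ starts (z ∷ τ) (x ∷ ρ) + μ (z ∷ τ) ρ
μ-∷ z τ x ρ with length τ ≤? length ρ
... | yes fits = begin
  μ (z ∷ τ) (x ∷ ρ)
    ≡⟨ cong (length ∘ filter P? ∘ upTo) (+-∸-assoc 1 fits) ⟩
  length (filter P? (0 ∷ applyUpTo suc N))
    ≡⟨ count-∷ P? 0 (applyUpTo suc N) ⟩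
  starts (z ∷ τ) (x ∷ ρ) + length (filter P? (applyUpTo suc N))
    ≡⟨ cong (λ is → starts (z ∷ τ) (x ∷ ρ) + length (filter P? is)) (map-upTo suc N) ⟨
  starts (z ∷ τ) (x ∷ ρ) + length (filter P? (map suc (upTo N)))
    ≡⟨ cong (starts (z ∷ τ) (x ∷ ρ) +_) (count-map P? suc (upTo N)) ⟩
  starts (z ∷ τ) (x ∷ ρ) + μ (z ∷ τ) ρ ∎
  where
  open ≡-Reasoning
  N = length ρ ∸ length τ
  P? = occursAt? (z ∷ τ) (x ∷ ρ)
... | no ¬fits = begin
  μ (z ∷ τ) (x ∷ ρ)
    ≡⟨ cong (length ∘ filter (occursAt? (z ∷ τ) (x ∷ ρ)) ∘ upTo) (m≤n⇒m∸n≡0 short) ⟩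
  0
    ≡⟨ cong (length ∘ filter (occursAt? (z ∷ τ) ρ) ∘ upTo) (m≤n⇒m∸n≡0 (<⇒≤ short)) ⟨
  μ (z ∷ τ) ρ
    ≡⟨ cong (_+ μ (z ∷ τ) ρ) (starts-no (z ∷ τ) (x ∷ ρ) λ (eq , _) →
         ¬fits (m⊓n≡m⇒m≤n (trans (sym (length-take (length τ) ρ)) (suc-injective eq)))) ⟨
  starts (z ∷ τ) (x ∷ ρ) + μ (z ∷ τ) ρ ∎
  where
  open ≡-Reasoning
  short : length ρ < length τ
  short = ≰⇒> ¬fits

μ-[] : ∀ z τ → μ (z ∷ τ) [] ≡ 0
μ-[] z τ = cong (length ∘ filter (occursAt? (z ∷ τ) []) ∘ upTo) (0∸n≡0 (length τ))

-- Sums over lists of continuations.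

total : ∀ {n} → (List ℕ → ℕ) → List (Vec ℕ n) → ℕ
total f ws = sum (map (f ∘ toList) ws)

total-++ : ∀ {n} f (us vs : List (Vec ℕ n)) → total f (us ++ vs) ≡ total f us + total f vs
total-++ f us vs = trans (cong sum (map-++ (f ∘ toList) us vs)) (sum-++ (map (f ∘ toList) us) _)

total-∷ : ∀ {n} f x (ws : List (Vec ℕ n)) → total f (map (x ∷_) ws) ≡ total (f ∘ (x ∷_)) ws
total-∷ f x ws = cong sum (sym (map-∘ ws))

total-cong : ∀ {n} {f g} → (∀ w → f w ≡ g w) → (ws : List (Vec ℕ n)) → total f ws ≡ total g ws
total-cong eq ws = cong sum (map-cong (eq ∘ toList) ws)

total-0 : ∀ {n} {f} → (∀ w → f w ≡ 0) → (ws : List (Vec ℕ n)) → total f ws ≡ 0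
total-0 eq []       = refl
total-0 eq (w ∷ ws) = cong₂ _+_ (eq (toList w)) (total-0 eq ws)

total-+ : ∀ {n} f g (ws : List (Vec ℕ n)) → total (λ w → f w + g w) ws ≡ total f ws + total g ws
total-+ f g []       = refl
total-+ f g (w ∷ ws) = trans (cong (f (toList w) + g (toList w) +_) (total-+ f g ws))
  (interchange +-commutativeSemigroup (f (toList w)) (g (toList w)) _ _)

total-continuations : ∀ f k s n → total f (continuations k s (suc n)) ≡
  total (f ∘ (suc k ∷_)) (continuations (suc k) (suc k ∷ s) n) + total f (recurrences k s n)
total-continuations f k s n = trans (total-++ f (map (suc k ∷_) (continuations (suc k) (suc k ∷ s) n)) _)
  (cong (_+ total f (recurrences k s n)) (total-∷ f (suc k) (continuations (suc k) (suc k ∷ s) n)))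

total-recurrences : ∀ f k x s n → total f (recurrences k (x ∷ s) n) ≡
  total (f ∘ (x ∷_)) (continuations k (x ∷ s) n) + total f (recurrences k s n)
total-recurrences f k x s n = trans (total-++ f (map (x ∷_) (continuations k (x ∷ s) n)) _)
  (cong (_+ total f (recurrences k s n)) (total-∷ f x (continuations k (x ∷ s) n)))

total-recurrences-0 : ∀ f k s n → All (λ y → ∀ w → f (y ∷ w) ≡ 0) s → total f (recurrences k s n) ≡ 0
total-recurrences-0 f k []      n []       = refl
total-recurrences-0 f k (x ∷ s) n (p ∷ ps) = trans (total-recurrences f k x s n)
  (cong₂ _+_ (total-0 p (continuations k (x ∷ s) n)) (total-recurrences-0 f k s n ps))

mutual
  -- The state matters only through the height of its stack.
  total-1-continuations : ∀ k s n → total (λ _ → 1) (continuations k s n) ≡ ballot (length s) n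
  total-1-continuations k s zero    = refl
  total-1-continuations k s (suc n) = trans (total-continuations (λ _ → 1) k s n)
    (cong₂ _+_ (total-1-continuations (suc k) (suc k ∷ s) n) (total-1-recurrences k s n))

  total-1-recurrences : ∀ k s n → total (λ _ → 1) (recurrences k s n) ≡ Σ≤ (length s) λ j → ballot j n
  total-1-recurrences k []      n = refl
  total-1-recurrences k (x ∷ s) n = trans (total-recurrences (λ _ → 1) k x s n)
    (cong₂ _+_ (total-1-continuations k (x ∷ s) n) (total-1-recurrences k s n))

-- Shifts in the word length.

-- The value below `d` must be 0, since a window that does not fit counts nothing; `f (n ∸ d)` would
-- give `f 0` there.
delay : ℕ → (ℕ → ℕ) → ℕ → ℕ
delay zero    f n       = f n
delay (suc d) f zero    = 0
delay (suc d) f (suc n) = delay d f n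

delay-∸ : ∀ {d n} f → d ≤ n → delay d f n ≡ f (n ∸ d)
delay-∸ f z≤n       = refl
delay-∸ f (s≤s d≤n) = delay-∸ f d≤n

delay-zero : ∀ d {f} → f 0 ≡ 0 → delay d f 0 ≡ 0
delay-zero zero    eq = eq
delay-zero (suc d) eq = refl

-- The sides could differ only at `d = suc n`, where the left is `f 0` and the right is the default
-- 0.
delay-suc : ∀ d {f} n → f 0 ≡ 0 → delay d f (suc n) ≡ delay d (f ∘ suc) n
delay-suc zero          n       eq = refl
delay-suc (suc d)       (suc n) eq = delay-suc d n eq
delay-suc (suc d)       zero    eq = delay-zero d eq

delay-plus : ∀ d f g n → delay d f n + delay d g n ≡ delay d (λ r → f r + g r) n
delay-plus zero    f g n       = refl
delay-plus (suc d) f g zero    = refl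
delay-plus (suc d) f g (suc n) = delay-plus d f g n

delay-Σ≤ : ∀ d h (f : ℕ → ℕ → ℕ) n → Σ≤ h (λ j → delay d (f j) n) ≡ delay d (λ r → Σ≤ h (λ j → f j r)) n
delay-Σ≤ zero    h       f n       = refl
delay-Σ≤ (suc d) zero    f zero    = refl
delay-Σ≤ (suc d) (suc h) f zero    = delay-Σ≤ (suc d) h f zero
delay-Σ≤ (suc d) h       f (suc n) = delay-Σ≤ d h f n

-- The recurrence for total occurrences, common to both patterns.

-- An occurrence at the first letter uses up the next `d` letters and raises the stack by `c`.
module _ (z : ℕ) (τ : List ℕ) (c d : ℕ)
  (total-starts : ∀ {k x s} n → Descending k (x ∷ s) →
    total (starts (z ∷ τ) ∘ (x ∷_)) (continuations k (x ∷ s) n) ≡ delay d (ballot (c + suc (length s))) n)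
  where

  private
    step : ℕ → ℕ → ℕ
    step j r = ballot (c + j) r + risers c j r

  mutual
    total-μ-∷ : ∀ {k x s} n → Descending k (x ∷ s) →
      total (μ (z ∷ τ) ∘ (x ∷_)) (continuations k (x ∷ s) n) ≡ delay d (step (suc (length s))) n
    total-μ-∷ {k} {x} {s} n ds = trans (total-cong (μ-∷ z τ x) ws)
      (trans (total-+ (starts (z ∷ τ) ∘ (x ∷_)) (μ (z ∷ τ)) ws) (trans
        (cong₂ _+_ (total-starts n ds) (total-μ-continuations n ds))
        (delay-plus d (ballot (c + suc (length s))) (risers c (suc (length s))) n)))
      where ws = continuations k (x ∷ s) n

    total-μ-continuations : ∀ {k s} n → Descending k s →
      total (μ (z ∷ τ)) (continuations k s n) ≡ delay d (risers c (length s)) n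
    total-μ-continuations zero ds = trans (cong (_+ 0) (μ-[] z τ)) (sym (delay-zero d refl))
    total-μ-continuations {k} {s} (suc n) ds = trans (total-continuations (μ (z ∷ τ)) k s n)
      (trans (cong₂ _+_ (total-μ-∷ n (push ds)) (total-μ-recurrences n ds))
      -- The delayed sum is that of `risers` at the successor; `delay-suc` applies since `risers`
      -- vanishes at length 0.
      (trans (delay-Σ≤ d (suc (length s)) step n) (sym (delay-suc d n refl))))

    total-μ-recurrences : ∀ {k s} n → Descending k s →
      total (μ (z ∷ τ)) (recurrences k s n) ≡ Σ≤ (length s) (λ j → delay d (step j) n)
    total-μ-recurrences {s = []}    n _  = refl
    total-μ-recurrences {k} {x ∷ s} n ds = trans (total-recurrences (μ (z ∷ τ)) k x s n)
      (cong₂ _+_ (total-μ-∷ n ds) (total-μ-recurrences n (pop ds)))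

  totalOccurrences≡risers : ∀ n → totalOccurrences (z ∷ τ) n ≡ delay d (risers c 0) n
  totalOccurrences≡risers n = trans (sum-↭ (map⁺ (μ (z ∷ τ) ∘ toList) (NC-↭-continuations n)))
    (total-μ-continuations n ([] ∷ []))

-- Counting occurrences at a first letter.

module _ (z : ℕ) (v : List ℕ) (c d : ℕ)
  (base : ∀ {k x s} n → Descending k (x ∷ s) →
    total (starts (z ∷ v) ∘ (x ∷_)) (continuations k (x ∷ s) n) ≡ delay d (ballot (c + suc (length s))) n)
  where

  -- Pushing or popping changes the letter, so only the branch that repeats `x` contributes. It
  -- keeps the state and removes one letter from the run.
  total-starts-replicate : ∀ m {k x s} n → Descending k (x ∷ s) →
    total (starts (z ∷ replicate m z ++ v) ∘ (x ∷_)) (continuations k (x ∷ s) n) ≡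
    delay (m + d) (ballot (c + suc (length s))) n
  total-starts-replicate zero n ds = base n ds
  total-starts-replicate (suc m) {x = x} zero ds =
    cong (_+ 0) (starts-no (z ∷ z ∷ replicate m z ++ v) (x ∷ []) λ { (() , _) })
  total-starts-replicate (suc m) {k} {x} {s} (suc n) ds@((x≤k ∷ _) ∷ s<x ∷ _) = begin
    total f (continuations k (x ∷ s) (suc n))
      ≡⟨ total-continuations f k (x ∷ s) n ⟩
    total (f ∘ (suc k ∷_)) (continuations (suc k) (suc k ∷ x ∷ s) n) + total f (recurrences k (x ∷ s) n)
      ≡⟨ cong₂ _+_ (total-0 (λ w → starts-≢ z u w (<⇒≢ x≤k)) (continuations (suc k) (suc k ∷ x ∷ s) n))
           (total-recurrences f k x s n) ⟩
    total (f ∘ (x ∷_)) (continuations k (x ∷ s) n) + total f (recurrences k s n)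
      ≡⟨ cong₂ _+_ (total-cong (starts-repeat z u x) (continuations k (x ∷ s) n))
           (total-recurrences-0 f k s n (All.map (λ y<x w → starts-≢ z u w (≢-sym (<⇒≢ y<x))) s<x)) ⟩
    total (starts (z ∷ u) ∘ (x ∷_)) (continuations k (x ∷ s) n) + 0
      ≡⟨ +-identityʳ _ ⟩
    total (starts (z ∷ u) ∘ (x ∷_)) (continuations k (x ∷ s) n)
      ≡⟨ total-starts-replicate m n ds ⟩
    delay (m + d) (ballot (c + suc (length s))) n ∎
    where
    open ≡-Reasoning
    u = replicate m z ++ v
    f = starts (z ∷ z ∷ u) ∘ (x ∷_)

total-starts-1 : ∀ {k x s} n → Descending k (x ∷ s) →
  total (starts (1 ∷ []) ∘ (x ∷_)) (continuations k (x ∷ s) n) ≡ ballot (suc (length s)) n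
total-starts-1 {k} {x} {s} n _ = trans
  (total-cong (λ w → starts-yes (1 ∷ []) (x ∷ w) (OrderIsomorphic-1 x)) (continuations k (x ∷ s) n))
  (total-1-continuations k (x ∷ s) n)

-- Only a push rises above `x`, the largest letter on the stack; the rest continues from a stack one
-- higher.
total-starts-12 : ∀ {k x s} n → Descending k (x ∷ s) →
  total (starts (1 ∷ 2 ∷ []) ∘ (x ∷_)) (continuations k (x ∷ s) n) ≡ delay 1 (ballot (1 + suc (length s))) n
total-starts-12 {x = x} zero ds = cong (_+ 0) (starts-no (1 ∷ 2 ∷ []) (x ∷ []) λ { (() , _) })
total-starts-12 {k} {x} {s} (suc n) ds@((x≤k ∷ _) ∷ s<x ∷ _) = begin
  total f (continuations k (x ∷ s) (suc n))
    ≡⟨ total-continuations f k (x ∷ s) n ⟩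
  total (f ∘ (suc k ∷_)) (continuations (suc k) (suc k ∷ x ∷ s) n) + total f (recurrences k (x ∷ s) n)
    ≡⟨ cong₂ _+_
         (trans (total-cong ascends (continuations (suc k) (suc k ∷ x ∷ s) n))
                (total-1-continuations (suc k) (suc k ∷ x ∷ s) n))
         (total-recurrences-0 f k (x ∷ s) n (All.map descends (≤-refl ∷ All.map <⇒≤ s<x))) ⟩
  ballot (2 + length s) n + 0
    ≡⟨ +-identityʳ _ ⟩
  ballot (2 + length s) n ∎
  where
  open ≡-Reasoning
  f = starts (1 ∷ 2 ∷ []) ∘ (x ∷_)

  ascends : ∀ w → f (suc k ∷ w) ≡ 1
  ascends w = starts-yes (1 ∷ 2 ∷ []) (x ∷ suc k ∷ w) (OrderIsomorphic-12⁺ x≤k)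

  descends : ∀ {y} → y ≤ x → ∀ w → f (y ∷ w) ≡ 0
  descends {y} y≤x w = starts-no (1 ∷ 2 ∷ []) (x ∷ y ∷ w) (≤⇒≯ y≤x ∘ OrderIsomorphic-12⁻)

-- Totals for 1^m and 1^m 2.

totalOccurrences-ones : ∀ m n → totalOccurrences (ones (suc m)) n ≡ delay m (risers 0 0) n
totalOccurrences-ones m n = begin
  totalOccurrences (ones (suc m)) n
    ≡⟨ cong (λ τ → totalOccurrences (1 ∷ τ) n) (++-identityʳ (replicate m 1)) ⟨
  totalOccurrences (1 ∷ replicate m 1 ++ []) n
    ≡⟨ totalOccurrences≡risers 1 (replicate m 1 ++ []) 0 (m + 0)
         (total-starts-replicate 1 [] 0 0 total-starts-1 m) n ⟩
  delay (m + 0) (risers 0 0) n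
    ≡⟨ cong (λ d → delay d (risers 0 0) n) (+-identityʳ m) ⟩
  delay m (risers 0 0) n ∎
  where open ≡-Reasoning

totalOccurrences-ones2 : ∀ m n → totalOccurrences (ones2 (suc m)) n ≡ delay (suc m) (risers 1 0) n
totalOccurrences-ones2 m n = trans
  (totalOccurrences≡risers 1 (replicate m 1 ++ 2 ∷ []) 1 (m + 1)
    (total-starts-replicate 1 (2 ∷ []) 1 1 total-starts-12 m) n)
  (cong (λ d → delay d (risers 1 0) n) (+-comm m 1))

corollary3 : ∀ (n m : ℕ) → 1 ≤ m → m ≤ n →
    let r = (n ∸ m) + 1 in
    totalOccurrences (ones m) n ≡ (2 * r) C (r + 1) ×
    totalOccurrences (ones2 m) n ≡ (2 * r ∸ 1) C (r + 1)
corollary3 n (suc m) _ m<n =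
  -- The delays `m` and `suc m` leave the lengths `suc (n ∸ suc m)` and `n ∸ suc m`.
  trans (totalOccurrences-ones m n) (trans (delay-∸ (risers 0 0) (<⇒≤ m<n))
    (trans (cong (risers 0 0) n∸m) (risers₀ (n ∸ suc m)))) ,
  trans (totalOccurrences-ones2 m n) (trans (delay-∸ (risers 1 0) m<n) (risers₁ (n ∸ suc m)))
  where
  n∸m : n ∸ m ≡ suc (n ∸ suc m)
  n∸m = +-∸-assoc 1 m<n
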